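{- Let $1\le i<j\le N$. Then $|\mathbf{M}_{j,i}|=(-1)^{i-j}$ if $n_i$ is forward-connected to $n_j$, and $|\mathbf{M}_{j,i}|=0$ otherwise.
   Context: Let $G$ be a finite tree (connected acyclic simple graph) with nodes $n_0,n_1,\dots,n_N$, where $n_0$ is a terminal node (degree one) and the nodes are indexed so that along the path in $G$ from $n_0$ to any node $n_i$ the successively encountered node indices strictly increase. Node $n_i$ is forward-adjacent to $n_k$ if $n_i$ and $n_k$ are adjacent and $i<k$. Node $n_i$ is forward-connected to $n_j$ ($i<j$ necessarily) if there is a sequence of nodes $n_i=n_{l_0},n_{l_1},\dots,n_{l_m}=n_j$ with $m\ge 1$ in which each $n_{l_t}$ is forward-adjacent to $n_{l_{t+1}}$. The forward adjacency matrix $\mathbf{A}$ of $G$ is the $N\times N$ matrix, with rows and columns indexed by $1,\dots,N$, given by $\mathbf{A}(i,j)=1$ if $i=j$, $\mathbf{A}(i,j)=-1$ if $n_i$ is forward-adjacent to $n_j$, and $\mathbf{A}(i,j)=0$ otherwise. $\mathbf{M}_{j,i}$ is the $(N-1)\times(N-1)$ matrix obtained from $\mathbf{A}$ by deleting its $j$-th row and $i$-th column, and $|\cdot|$ denotes the determinant. -}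

module Defs where

open import Algebra.Properties.CommutativeMonoid.Sum as Sum using ()
open import Data.Bool.Base using (if_then_else_)
open import Data.Fin.Base using (Fin; zero; suc; toℕ; punchIn; _<_)
open import Data.Fin.Properties using (_≟_; _<?_)
open import Data.Integer.Base using (ℤ; +_; 0ℤ; 1ℤ; -1ℤ; _*_; _^_; ∣_∣)
open import Data.Integer.Properties using (+-0-commutativeMonoid)
open import Data.List.Base using (List; []; _∷_; length; filter; allFin)
open import Data.List.Relation.Unary.Linked using (Linked)
open import Data.List.Relation.Unary.Unique.Propositional using (Unique)
open import Data.Nat.Base using (ℕ; zero; suc; pred; _≤_)
open import Data.Product.Base using (Σ-syntax; _×_)
open import Data.Vec.Functional using (Vector)
open import Level using (0ℓ)
open import Relation.Binary.Construct.Closure.ReflexiveTransitive using (Star; ε; _◅_)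
open import Relation.Binary.Construct.Closure.Transitive using (TransClosure)
open import Relation.Binary.Core using (Rel)
open import Relation.Binary.Definitions using (Decidable; Irreflexive; Symmetric)
open import Relation.Binary.PropositionalEquality.Core using (_≡_)
open import Relation.Nullary.Decidable using (does; _×-dec_)
open import Relation.Nullary.Negation using (¬_)

open Sum +-0-commutativeMonoid using (sum)

record SimpleGraph (n : ℕ) : Set₁ where
  field
    Adj        : Rel (Fin n) 0ℓ
    adj?       : Decidable Adj
    adj-sym    : Symmetric Adj
    adj-irrefl : Irreflexive _≡_ Adj

  Walk : Rel (Fin n) 0ℓ
  Walk = Star Adj

  -- Both endpoints are included, so the list is never empty.
  nodes : ∀ {u v} → Walk u v → List (Fin n)
  nodes {u} ε       = u ∷ []
  nodes {u} (_ ◅ w) = u ∷ nodes w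

  IsPath : ∀ {u v} → Walk u v → Set
  IsPath w = Unique (nodes w)

  Connected : Set
  Connected = ∀ u v → Walk u v

  -- A cycle is a path on at least three nodes whose endpoints are adjacent.
  Cycle : Set
  Cycle = Σ[ u ∈ Fin n ] Σ[ v ∈ Fin n ] Σ[ w ∈ Walk u v ]
    (IsPath w × 3 ≤ length (nodes w) × Adj v u)

  IsTree : Set
  IsTree = Connected × ¬ Cycle

  degree : Fin n → ℕ
  degree v = length (filter (adj? v) (allFin n))

  IsTerminal : Fin n → Set
  IsTerminal v = degree v ≡ 1

  IncreasingFrom : Fin n → Set
  IncreasingFrom r = ∀ v (w : Walk r v) → IsPath w → Linked _<_ (nodes w)

  ForwardAdjacent : Rel (Fin n) 0ℓ
  ForwardAdjacent u v = Adj u v × u < v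

  forwardAdjacent? : Decidable ForwardAdjacent
  forwardAdjacent? u v = adj? u v ×-dec u <? v

  ForwardConnected : Rel (Fin n) 0ℓ
  ForwardConnected = TransClosure ForwardAdjacent

Matrix : ℕ → Set
Matrix n = Vector (Vector ℤ n) n

deleteRowCol : ∀ {n} → Matrix n → Fin n → Fin n → Matrix (pred n)
deleteRowCol {suc n} A r c i j = A (punchIn r i) (punchIn c j)

-- Cofactor expansion along the first row.
det : ∀ {n} → Matrix n → ℤ
det {zero}  A = 1ℤ
det {suc n} A =
  sum λ k → -1ℤ ^ toℕ k * A zero k * det {n} (deleteRowCol A zero k)

-- -1 is its own inverse, so its integer powers only depend on ∣ z ∣.
[-1]^_ : ℤ → ℤ
[-1]^ z = -1ℤ ^ ∣ z ∣

-- The root `zero` has no row or column: index i stands for the node `suc i`.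
forwardAdjacencyMatrix : ∀ {N} → SimpleGraph (suc N) → Matrix N
forwardAdjacencyMatrix G i j =
  if does (i ≟ j) then 1ℤ
  else if does (forwardAdjacent? (suc i) (suc j)) then -1ℤ
  else 0ℤ
  where open SimpleGraph G

{-# OPTIONS --safe #-}
-- Expanding the minor M_{j,0} along its first row gives the minors M_{j',k} of
-- the matrix with the first row and column removed, so (-1)^(i+j) |M_{j,i}|
-- satisfies the recursion counting the forward paths from i to j.  In a tree
-- whose indices increase away from the root every node has at most one smaller
-- neighbour: two of them would be joined by a path of still smaller nodes,
-- closing a cycle.  Hence there is at most one forward path.
module Submission where

open import Defs
open import Algebra.Properties.CommutativeMonoid.Sum as Sum using ()
open import Data.Fin.Base using (Fin; zero; suc; toℕ; punchIn; _<_)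
open import Data.Fin.Properties using (_≟_; punchInᵢ≢i; suc-injective)
open import Data.Integer.Base using (ℤ; +_; 0ℤ; 1ℤ; -1ℤ; _+_; _*_; _^_; _-_; _⊖_)
import Data.Integer.Properties as ℤ
open import Data.List.Membership.Propositional using (_∈_)
open import Data.List.Base using (length)
open import Data.List.Relation.Unary.All as All using (All; []; _∷_)
open import Data.List.Relation.Unary.All.Properties using (¬Any⇒All¬)
open import Data.List.Relation.Unary.AllPairs using ([]; _∷_)
open import Data.List.Relation.Unary.Any using (here; there)
open import Data.List.Relation.Unary.Linked using (Linked; [-]; _∷_)
open import Data.Nat.Base as ℕ using (ℕ; zero; suc; z≤n; s≤s; _∸_)
import Data.Nat.Properties as ℕ
open import Data.Product.Base using (Σ-syntax; _×_; _,_; proj₁; proj₂)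
open import Data.Sum.Base using (_⊎_; inj₁; inj₂)
open import Data.Vec.Functional using (Vector)
open import Function.Base using (_on_; _∘_)
open import Level using (0ℓ)
open import Relation.Binary.Construct.Closure.ReflexiveTransitive using (Star; ε; _◅_)
open import Relation.Binary.Construct.Closure.Transitive using (TransClosure; [_]; _∷_)
open import Relation.Binary.Core using (Rel; _⇒_)
open import Relation.Binary.Definitions using (Decidable)
open import Relation.Binary.PropositionalEquality
  using (_≡_; _≢_; refl; sym; trans; cong; cong₂; module ≡-Reasoning)
open import Relation.Nullary.Decidable using (yes; no; dec-true; dec-false)
open import Relation.Nullary.Negation using (¬_; contradiction)
open import Relation.Unary.Properties using (U-Universal)

open Sum ℤ.+-0-commutativeMonoid using (sum; sum-cong-≗; sum-replicate-zero; sum-remove)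

sum-zero : ∀ {n} (t : Vector ℤ n) → (∀ k → t k ≡ 0ℤ) → sum t ≡ 0ℤ
sum-zero {n} t t≡0 = trans (sum-cong-≗ t≡0) (sum-replicate-zero n)

sum-single : ∀ {n} (t : Vector ℤ n) i → (∀ k → k ≢ i → t k ≡ 0ℤ) → sum t ≡ t i
sum-single {suc n} t i t≡0 = begin
  sum t                           ≡⟨ sum-remove {i = i} t ⟩
  t i + sum (t ∘ punchIn i)       ≡⟨ cong (_+_ (t i)) (sum-zero _ λ k → t≡0 _ (punchInᵢ≢i i k)) ⟩
  t i + 0ℤ                        ≡⟨ ℤ.+-identityʳ (t i) ⟩
  t i                             ∎
  where open ≡-Reasoning

-1^2m≡1 : ∀ m → -1ℤ ^ (m ℕ.+ m) ≡ 1ℤ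
-1^2m≡1 zero    = refl
-1^2m≡1 (suc m) rewrite ℕ.+-suc m m | -1^2m≡1 m = refl

-1^[2m+n] : ∀ m n → -1ℤ ^ (m ℕ.+ (m ℕ.+ n)) ≡ -1ℤ ^ n
-1^[2m+n] m n = begin
  -1ℤ ^ (m ℕ.+ (m ℕ.+ n))       ≡⟨ cong (-1ℤ ^_) (sym (ℕ.+-assoc m m n)) ⟩
  -1ℤ ^ (m ℕ.+ m ℕ.+ n)         ≡⟨ ℤ.^-distribˡ-+-* -1ℤ (m ℕ.+ m) n ⟩
  -1ℤ ^ (m ℕ.+ m) * -1ℤ ^ n     ≡⟨ cong (_* -1ℤ ^ n) (-1^2m≡1 m) ⟩
  1ℤ * -1ℤ ^ n                  ≡⟨ ℤ.*-identityˡ _ ⟩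
  -1ℤ ^ n                       ∎
  where open ≡-Reasoning

-1^[1+m+1+n] : ∀ m n → -1ℤ ^ (suc m ℕ.+ suc n) ≡ -1ℤ ^ (m ℕ.+ n)
-1^[1+m+1+n] m n =
  trans (cong (λ k → -1ℤ ^ suc k) (ℕ.+-suc m n)) (-1^[2m+n] 1 (m ℕ.+ n))

[-1]^-difference : ∀ {m n} → m ℕ.≤ n → [-1]^ (+ m - + n) ≡ -1ℤ ^ (m ℕ.+ n)
[-1]^-difference {m} {n} m≤n = begin
  [-1]^ (+ m - + n)                  ≡⟨ cong [-1]^_ (ℤ.[+m]-[+n]≡m⊖n m n) ⟩
  [-1]^ (m ⊖ n)                      ≡⟨ cong (-1ℤ ^_) (ℤ.∣⊖∣-≤ m≤n) ⟩
  -1ℤ ^ (n ∸ m)                      ≡⟨ -1^[2m+n] m (n ∸ m) ⟨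
  -1ℤ ^ (m ℕ.+ (m ℕ.+ (n ∸ m)))      ≡⟨ cong (λ x → -1ℤ ^ (m ℕ.+ x)) (ℕ.m+[n∸m]≡n m≤n) ⟩
  -1ℤ ^ (m ℕ.+ n)                    ∎
  where open ≡-Reasoning

term-zeroˡ : ∀ s {a} d → a ≡ 0ℤ → s * a * d ≡ 0ℤ
term-zeroˡ s d refl = cong (_* d) (ℤ.*-zeroʳ s)

term-zeroʳ : ∀ s a {d} → d ≡ 0ℤ → s * a * d ≡ 0ℤ
term-zeroʳ s a refl = ℤ.*-zeroʳ (s * a)

det-zero-column : ∀ {n} (A : Matrix (suc n)) → (∀ r → A r zero ≡ 0ℤ) → det A ≡ 0ℤ
det-zero-column {n} A A≡0 = sum-zero _ (term n A A≡0)
  where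
  term : ∀ n (A : Matrix (suc n)) → (∀ r → A r zero ≡ 0ℤ) →
         ∀ k → -1ℤ ^ toℕ k * A zero k * det (deleteRowCol A zero k) ≡ 0ℤ
  term n       A A≡0 zero    = term-zeroˡ 1ℤ _ (A≡0 zero)
  term (suc n) A A≡0 (suc k) =
    term-zeroʳ (-1ℤ ^ toℕ (suc k)) _
      (det-zero-column (deleteRowCol A zero (suc k)) (A≡0 ∘ suc))

det-unit-column : ∀ {n} (A : Matrix (suc n)) → A zero zero ≡ 1ℤ →
                  (∀ r → A (suc r) zero ≡ 0ℤ) → det A ≡ det (deleteRowCol A zero zero)
det-unit-column {n} A A≡1 A≡0 = begin
  det A                                         ≡⟨ sum-single _ zero (off n A A≡0) ⟩
  1ℤ * A zero zero * det (deleteRowCol A zero zero)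
                                                ≡⟨ cong (λ a → 1ℤ * a * det (deleteRowCol A zero zero)) A≡1 ⟩
  1ℤ * det (deleteRowCol A zero zero)           ≡⟨ ℤ.*-identityˡ _ ⟩
  det (deleteRowCol A zero zero)                ∎
  where
  open ≡-Reasoning
  off : ∀ n (A : Matrix (suc n)) → (∀ r → A (suc r) zero ≡ 0ℤ) →
        ∀ k → k ≢ zero → -1ℤ ^ toℕ k * A zero k * det (deleteRowCol A zero k) ≡ 0ℤ
  off n       A A≡0 zero    k≢0 = contradiction refl k≢0
  off (suc n) A A≡0 (suc k) _   =
    term-zeroʳ (-1ℤ ^ toℕ (suc k)) _
      (det-zero-column (deleteRowCol A zero (suc k)) A≡0)

det-unitriangular : ∀ {n} (A : Matrix n) → (∀ i → A i i ≡ 1ℤ) →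
                    (∀ {i j} → j < i → A i j ≡ 0ℤ) → det A ≡ 1ℤ
det-unitriangular {zero}  A diag lower = refl
det-unitriangular {suc n} A diag lower = trans
  (det-unit-column A (diag zero) (λ r → lower (s≤s z≤n)))
  (det-unitriangular _ (diag ∘ suc) (lower ∘ s≤s))

record IsIncreasingForest {n} (R : Rel (Fin n) 0ℓ) : Set where
  field
    R?            : Decidable R
    increasing    : R ⇒ _<_
    unique-parent : ∀ {i j k} → R i k → R j k → i ≡ j

  Star⇒≤ : ∀ {i j} → Star R i j → toℕ i ℕ.≤ toℕ j
  Star⇒≤ ε       = ℕ.≤-refl
  Star⇒≤ (r ◅ p) = ℕ.≤-trans (ℕ.<⇒≤ (increasing r)) (Star⇒≤ p)

  via-parent : ∀ {i j k} → Star R i k → R j k → i ≡ k ⊎ Star R i j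
  via-parent ε       r = inj₁ refl
  via-parent (s ◅ p) r with via-parent p r
  ... | inj₂ q    = inj₂ (s ◅ q)
  ... | inj₁ refl with refl ← unique-parent s r = inj₂ ε

  ancestors-comparable : ∀ {i j k} → Star R i k → Star R j k → Star R i j ⊎ Star R j i
  ancestors-comparable ε       q = inj₂ q
  ancestors-comparable (r ◅ p) q with ancestors-comparable p q
  ... | inj₁ s = inj₁ (r ◅ s)
  ... | inj₂ s with via-parent s r
  ...   | inj₁ refl = inj₁ (r ◅ ε)
  ...   | inj₂ t    = inj₂ t

  connected-siblings : ∀ {i j k} → R i j → R i k → Star R j k → j ≡ k
  connected-siblings r s p with via-parent p s
  ... | inj₁ j≡k = j≡k
  ... | inj₂ q   = contradiction (Star⇒≤ q) (ℕ.<⇒≱ (increasing r))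

  unique-child : ∀ {i j k l} → R i j → R i k → Star R j l → Star R k l → j ≡ k
  unique-child r s p q with ancestors-comparable p q
  ... | inj₁ t = connected-siblings r s t
  ... | inj₂ t = sym (connected-siblings s r t)

restrict : ∀ {n} {R : Rel (Fin (suc n)) 0ℓ} → R ⇒ _<_ →
           ∀ {i j} → Star R (suc i) (suc j) → Star (R on suc) i j
restrict inc ε                   = ε
restrict inc (_◅_ {j = zero}  r p) with () ← inc r
restrict inc (_◅_ {j = suc _} r p) = r ◅ restrict inc p

extend : ∀ {n} {R : Rel (Fin (suc n)) 0ℓ} {i j} →
         Star (R on suc) i j → Star R (suc i) (suc j)
extend ε       = ε
extend (r ◅ p) = r ◅ extend p

record IsForwardMatrix {n} (R : Rel (Fin n) 0ℓ) (A : Matrix n) : Set where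
  field
    diagonal : ∀ i → A i i ≡ 1ℤ
    edge     : ∀ {i j} → R i j → A i j ≡ -1ℤ
    non-edge : ∀ {i j} → i ≢ j → ¬ R i j → A i j ≡ 0ℤ

module _ {n} {R : Rel (Fin (suc n)) 0ℓ} where

  forest-tail : IsIncreasingForest R → IsIncreasingForest (R on suc)
  forest-tail F = record
    { R?            = λ i j → R? (suc i) (suc j)
    ; increasing    = ℕ.s≤s⁻¹ ∘ increasing
    ; unique-parent = λ r s → suc-injective (unique-parent r s)
    }
    where
    open IsIncreasingForest F

  matrix-tail : ∀ {A} → IsForwardMatrix R A →
                IsForwardMatrix (R on suc) (deleteRowCol A zero zero)
  matrix-tail M = record
    { diagonal = diagonal ∘ suc
    ; edge     = edge
    ; non-edge = λ i≢j → non-edge (λ { refl → i≢j refl })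
    }
    where open IsForwardMatrix M

lower-zero : ∀ {n} {R : Rel (Fin n) 0ℓ} {A} → IsIncreasingForest R → IsForwardMatrix R A →
             ∀ {i j} → j < i → A i j ≡ 0ℤ
lower-zero F M j<i =
  non-edge (λ { refl → ℕ.<-irrefl refl j<i }) (λ r → ℕ.<-asym j<i (increasing r))
  where open IsIncreasingForest F; open IsForwardMatrix M

-- Also for i ≥ j: expanding M_{j+1,0} involves M_{j,k} for every k.
MinorFormula : ∀ {n} → Rel (Fin n) 0ℓ → Matrix n → Fin n → Fin n → Set
MinorFormula R A i j =
    (Star R i j   → det (deleteRowCol A j i) ≡ -1ℤ ^ (toℕ i ℕ.+ toℕ j))
  × (¬ Star R i j → det (deleteRowCol A j i) ≡ 0ℤ)

minor-formula : ∀ {n} {R : Rel (Fin n) 0ℓ} {A : Matrix n} →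
                IsIncreasingForest R → IsForwardMatrix R A → ∀ i j → MinorFormula R A i j
minor-formula {suc n} {R} {A} F M zero zero =
    (λ _ → det-unitriangular _ (diagonal ∘ suc) (lower-zero F M ∘ s≤s))
  , (λ ¬p → contradiction ε ¬p)
  where open IsForwardMatrix M
minor-formula {suc (suc n)} {R} {A} F M (suc i) zero =
    (λ p → contradiction (Star⇒≤ p) λ ())
  , (λ _ → det-zero-column (deleteRowCol A zero (suc i)) (λ r → lower-zero F M (s≤s z≤n)))
  where open IsIncreasingForest F
minor-formula {suc (suc n)} {R} {A} F M (suc i) (suc j) =
    (λ p → trans first-column (trans (proj₁ ih (restrict increasing p)) (sym (-1^[1+m+1+n] (toℕ i) (toℕ j)))))
  , (λ ¬p → trans first-column (proj₂ ih (¬p ∘ extend)))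
  where
  open IsIncreasingForest F
  open IsForwardMatrix M
  ih = minor-formula (forest-tail F) (matrix-tail M) i j
  first-column : det (deleteRowCol A (suc j) (suc i)) ≡
                 det (deleteRowCol (deleteRowCol A zero zero) j i)
  first-column = det-unit-column (deleteRowCol A (suc j) (suc i)) (diagonal zero)
    (λ r → lower-zero F M (s≤s z≤n))
minor-formula {suc (suc n)} {R} {A} F M zero (suc j) = connected , disconnected
  where
  open IsIncreasingForest F
  open IsForwardMatrix M
  minor : Fin (suc n) → ℤ
  minor k = det (deleteRowCol (deleteRowCol A zero zero) j k)
  term : Fin (suc n) → ℤ
  term k = -1ℤ ^ toℕ k * A zero (suc k) * minor k
  ih : ∀ k → MinorFormula (R on suc) (deleteRowCol A zero zero) k j
  ih k = minor-formula (forest-tail F) (matrix-tail M) k j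

  term-zero : ∀ k → (R zero (suc k) → ¬ Star R (suc k) (suc j)) → term k ≡ 0ℤ
  term-zero k ¬via with R? zero (suc k)
  ... | no ¬r = term-zeroˡ (-1ℤ ^ toℕ k) (minor k) (non-edge (λ ()) ¬r)
  ... | yes r = term-zeroʳ (-1ℤ ^ toℕ k) (A zero (suc k)) (proj₂ (ih k) (¬via r ∘ extend))

  term-one : ∀ k → R zero (suc k) → Star R (suc k) (suc j) → term k ≡ -1ℤ ^ suc (toℕ j)
  term-one k r p = begin
    -1ℤ ^ toℕ k * A zero (suc k) * minor k
      ≡⟨ cong₂ (λ a d → -1ℤ ^ toℕ k * a * d) (edge r) (proj₁ (ih k) (restrict increasing p)) ⟩
    -1ℤ ^ toℕ k * -1ℤ * -1ℤ ^ (toℕ k ℕ.+ toℕ j)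
      ≡⟨ ℤ.*-assoc (-1ℤ ^ toℕ k) -1ℤ _ ⟩
    -1ℤ ^ toℕ k * -1ℤ ^ suc (toℕ k ℕ.+ toℕ j)
      ≡⟨ ℤ.^-distribˡ-+-* -1ℤ (toℕ k) _ ⟨
    -1ℤ ^ (toℕ k ℕ.+ suc (toℕ k ℕ.+ toℕ j))
      ≡⟨ cong (λ m → -1ℤ ^ (toℕ k ℕ.+ m)) (ℕ.+-suc (toℕ k) (toℕ j)) ⟨
    -1ℤ ^ (toℕ k ℕ.+ (toℕ k ℕ.+ suc (toℕ j)))
      ≡⟨ -1^[2m+n] (toℕ k) (suc (toℕ j)) ⟩
    -1ℤ ^ suc (toℕ j) ∎
    where open ≡-Reasoning

  connected : Star R zero (suc j) → det (deleteRowCol A (suc j) zero) ≡ -1ℤ ^ suc (toℕ j)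
  connected (_◅_ {j = zero}  r p) = contradiction (increasing r) λ ()
  connected (_◅_ {j = suc k} r p) = trans
    (sum-single term k (λ l l≢k → term-zero l (λ s q →
      l≢k (suc-injective (unique-child s r q p)))))
    (term-one k r p)

  disconnected : ¬ Star R zero (suc j) → det (deleteRowCol A (suc j) zero) ≡ 0ℤ
  disconnected ¬p = sum-zero term (λ k → term-zero k (λ r q → ¬p (r ◅ q)))

module _ {n} (G : SimpleGraph n) where
  open SimpleGraph G
  open import Data.List.Membership.DecPropositional (_≟_ {n}) using (_∈?_)

  WalkIn PathIn : (Fin n → Set) → Rel (Fin n) 0ℓ
  WalkIn P u v = Σ[ w ∈ Walk u v ] All P (nodes w)
  PathIn P u v = Σ[ w ∈ Walk u v ] (IsPath w × All P (nodes w))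

  module _ {P : Fin n → Set} where

    concatenate : ∀ {u v w} → WalkIn P u v → WalkIn P v w → WalkIn P u w
    concatenate (ε     , _)        q = q
    concatenate (e ◅ p , Pu ∷ Pp) q with r , Pr ← concatenate (p , Pp) q = e ◅ r , Pu ∷ Pr

    start : ∀ {u v} (p : Walk u v) → All P (nodes p) → P u
    start ε       (Pu ∷ _) = Pu
    start (_ ◅ _) (Pu ∷ _) = Pu

    reverse : ∀ {u v} → WalkIn P u v → WalkIn P v u
    reverse (ε     , Pp)      = ε , Pp
    reverse (e ◅ p , Pu ∷ Pp) =
      concatenate (reverse (p , Pp)) (adj-sym e ◅ ε , start p Pp ∷ Pu ∷ [])

    suffix : ∀ {u v x} ((p , _) : PathIn P u v) → x ∈ nodes p → PathIn P x v
    suffix p@(ε , _)     (here refl) = p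
    suffix p@(_ ◅ _ , _) (here refl) = p
    suffix (_ ◅ p , _ ∷ p! , _ ∷ Pp) (there x∈p) = suffix (p , p! , Pp) x∈p

    erase-loops : ∀ {u v} → WalkIn P u v → PathIn P u v
    erase-loops (ε , Pp) = ε , [] ∷ [] , Pp
    erase-loops {u} (e ◅ p , Pu ∷ Pp) with q@(w , w! , Pw) ← erase-loops (p , Pp) | u ∈? nodes w
    ... | yes u∈w = suffix q u∈w
    ... | no  u∉w = e ◅ w , ¬Any⇒All¬ _ u∉w ∷ w! , Pu ∷ Pw

  increasing-walk-below : ∀ {u v w : Fin n} (p : Walk u v) → Linked _<_ (nodes p) → v < w →
                          All (_< w) (nodes p)
  increasing-walk-below ε             _         v<w = v<w ∷ []
  increasing-walk-below (_ ◅ ε)       (u<x ∷ l) v<w =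
    ℕ.<-trans u<x v<w ∷ v<w ∷ []
  increasing-walk-below (_ ◅ p@(_ ◅ _)) (u<x ∷ l) v<w
    with x<w ∷ ps ← increasing-walk-below p l v<w = ℕ.<-trans u<x x<w ∷ x<w ∷ ps

  walk-from-root : ∀ {r} → Connected → IncreasingFrom r → ∀ {v w : Fin n} → v < w →
                   WalkIn (_< w) r v
  walk-from-root {r} conn inc {v} v<w
    with p , p! , _ ← erase-loops (conn r v , All.universal U-Universal _)
    = p , increasing-walk-below p (inc v p p!) v<w

  unique-smaller-neighbour : ∀ {r} → IsTree → IncreasingFrom r → ∀ {u v w} →
                             ForwardAdjacent u w → ForwardAdjacent v w → u ≡ v
  unique-smaller-neighbour (conn , acyclic) inc {u} {v} {w} (u~w , u<w) (v~w , v<w)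
    with u ≟ v
  ... | yes u≡v = u≡v
  ... | no  u≢v = contradiction (cycle (erase-loops (concatenate
      (reverse (walk-from-root conn inc u<w)) (walk-from-root conn inc v<w)))) acyclic
    where
    two-nodes : (p : Walk u v) → 2 ℕ.≤ length (nodes p)
    two-nodes ε             = contradiction refl u≢v
    two-nodes (_ ◅ ε)       = s≤s (s≤s z≤n)
    two-nodes (_ ◅ (_ ◅ _)) = s≤s (s≤s z≤n)

    cycle : PathIn (_< w) u v → Cycle
    cycle (p , p! , p<w) = w , v , adj-sym u~w ◅ p ,
      All.map (λ { x<w refl → ℕ.<-irrefl refl x<w }) p<w ∷ p! , s≤s (two-nodes p) , v~w

TransClosure⇒Star : ∀ {A : Set} {R : Rel A 0ℓ} {x y} → TransClosure R x y → Star R x y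
TransClosure⇒Star [ r ]   = r ◅ ε
TransClosure⇒Star (r ∷ p) = r ◅ TransClosure⇒Star p

Star⇒TransClosure : ∀ {A : Set} {R : Rel A 0ℓ} {x y} → x ≢ y → Star R x y → TransClosure R x y
Star⇒TransClosure x≢y ε       = contradiction refl x≢y
Star⇒TransClosure _   (r ◅ p) = prepend r p
  where
  prepend : ∀ {A : Set} {R : Rel A 0ℓ} {x y z} → R x y → Star R y z → TransClosure R x z
  prepend r ε       = [ r ]
  prepend r (s ◅ p) = r ∷ prepend s p

forwardAdjacencyMatrix-isForwardMatrix :
  ∀ {N} (G : SimpleGraph (suc N)) (let open SimpleGraph G) →
  IsForwardMatrix (ForwardAdjacent on suc) (forwardAdjacencyMatrix G)
forwardAdjacencyMatrix-isForwardMatrix G = record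
  { diagonal = diagonal ; edge = edge ; non-edge = non-edge }
  where
  open SimpleGraph G
  A = forwardAdjacencyMatrix G
  diagonal : ∀ i → A i i ≡ 1ℤ
  diagonal i rewrite dec-true (i ≟ i) refl = refl
  edge : ∀ {i j} → ForwardAdjacent (suc i) (suc j) → A i j ≡ -1ℤ
  edge {i} {j} r@(_ , i<j)
    rewrite dec-false (i ≟ j) (λ { refl → ℕ.<-irrefl refl i<j })
          | dec-true (forwardAdjacent? (suc i) (suc j)) r = refl
  non-edge : ∀ {i j} → i ≢ j → ¬ ForwardAdjacent (suc i) (suc j) → A i j ≡ 0ℤ
  non-edge {i} {j} i≢j ¬r
    rewrite dec-false (i ≟ j) i≢j
          | dec-false (forwardAdjacent? (suc i) (suc j)) ¬r = refl

lemma12 : ∀ (N : ℕ) (G : SimpleGraph (suc N)) (let open SimpleGraph G) →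
    IsTree → IsTerminal zero → IncreasingFrom zero →
    ∀ (i j : Fin N) → i < j →
    let |M| = det (deleteRowCol (forwardAdjacencyMatrix G) j i) in
    (ForwardConnected (suc i) (suc j) → |M| ≡ [-1]^ (+ toℕ (suc i) - + toℕ (suc j)))
    × (¬ ForwardConnected (suc i) (suc j) → |M| ≡ 0ℤ)
lemma12 N G tree _ inc i j i<j =
    (λ p → trans (proj₁ formula (restrict proj₂ (TransClosure⇒Star p))) sign)
  , (λ ¬p → proj₂ formula (¬p ∘ Star⇒TransClosure i≢j ∘ extend))
  where
  open SimpleGraph G
  forest : IsIncreasingForest ForwardAdjacent
  forest = record
    { R?            = forwardAdjacent?
    ; increasing    = proj₂
    ; unique-parent = unique-smaller-neighbour G tree inc
    }
  formula = minor-formula (forest-tail forest) (forwardAdjacencyMatrix-isForwardMatrix G) i j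
  i≢j : suc i ≢ suc j
  i≢j refl = ℕ.<-irrefl refl i<j
  sign : -1ℤ ^ (toℕ i ℕ.+ toℕ j) ≡ [-1]^ (+ toℕ (suc i) - + toℕ (suc j))
  sign = trans (sym (-1^[1+m+1+n] (toℕ i) (toℕ j)))
               (sym ([-1]^-difference (s≤s (ℕ.<⇒≤ i<j))))
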